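{- (Completeness) For every set $\Phi\subseteq\mathcal{L}_T$ and every $\alpha\in\mathcal{L}_T$: if $\Phi\models\alpha$, then $\Phi\vdash\alpha$ in SBTrust.
   Context: Propositional formulas: $\varphi::=\bot\mid p\mid\varphi\land\varphi\mid\varphi\lor\varphi\mid\varphi\to\varphi\mid\varphi\leftrightarrow\varphi\mid\neg\varphi$ over a countable set of variables. $\mathcal{L}_T$: $\alpha::=\varphi\mid\varphi\rightsquigarrow\varphi\mid B(\alpha)\mid\alpha*\alpha\mid\neg\alpha$ ($\varphi$ propositional, $*\in\{\land,\lor,\to,\leftrightarrow\}$). SBTrust is the Hilbert system (rule applications must yield formulas of $\mathcal{L}_T$; $\varphi,\psi,\chi,\varphi_i,\psi_i$ propositional; $\alpha,\beta\in\mathcal{L}_T$) with: all classical tautologies over $\mathcal{L}_T$ and Modus Ponens; $\mathbf{ID}$: $\varphi\rightsquigarrow\varphi$; $\mathbf{ST}$: $(\varphi\rightsquigarrow\bot)\to\neg\varphi$; $\mathbf{SH}$: $((\psi\land\chi)\rightsquigarrow\varphi)\to(\psi\rightsquigarrow(\chi\to\varphi))$; $\mathbf{LL+}$: $(\neg(\varphi\leftrightarrow\psi)\rightsquigarrow\bot)\to((\varphi\rightsquigarrow\chi)\leftrightarrow(\psi\rightsquigarrow\chi))$; rule $\mathbf{RCK}$: from $(\varphi_1\land\dots\land\varphi_n)\to\varphi_{n+1}$ infer $((\psi\rightsquigarrow\varphi_1)\land\dots\land(\psi\rightsquigarrow\varphi_n))\to(\psi\rightsquigarrow\varphi_{n+1})$;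 rule $\mathbf{S5_F}$: from $(\ell_1\land\dots\land\ell_n)\to\chi$ infer $(\ell_1\land\dots\land\ell_n)\to(\neg\chi\rightsquigarrow\bot)$, each $\ell_j$ being $\varphi_j\rightsquigarrow\psi_j$ or $\neg(\varphi_j\rightsquigarrow\psi_j)$, $\chi$ propositional; $\mathbf{KB}$: $B(\alpha\to\beta)\to(B(\alpha)\to B(\beta))$; $\mathbf{DB}$: $B(\alpha)\to\neg B(\neg\alpha)$; $\mathbf{4B}$: $B(\alpha)\to B(B(\alpha))$; necessitation for $B$. $\Phi\vdash\alpha$ is derivability from assumptions in the usual sense. A Trust model is $\mathcal{M}=\langle S,(S_i)_{i\in I},(\succeq_i)_{i\in I},R,V\rangle$: $R\subseteq S\times S$ serial and transitive; $(S_i)$ a partition of $S$; $\succeq_i\subseteq S_i\times S_i$ arbitrary; $V$ maps variables to subsets of $S$; and for each $i$ and propositional $\varphi$, $\|\varphi\|_i\neq\emptyset\Rightarrow\mathit{most}(\|\varphi\|_i)\neq\emptyset$, with $\|\varphi\|_i=\{v\in S_i:\mathcal{M},v\models\varphi\}$, $\mathit{most}(X)=\{s\in X:\forall v\in X\,(v\succeq_i s\Rightarrow s\succeq_i v)\}$. Truth: $s\models p$ iff $s\in V(p)$; Boolean clauses as usual; $s\models\varphi\rightsquigarrow\psi$ iff $\mathit{most}(\|\varphi\|_i)\subseteq\|\psi\|_i$ where $s\in S_i$; $s\models B(\alpha)$ iff $v\models\alpha$ for every $v$ with $sRv$. $\Phi\models\alpha$: in every Trust model, every state satisfying all of $\Phi$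 satisfies $\alpha$. -}

module Defs where

open import Data.Bool.Base as Bool using (Bool; true; false)
open import Data.Empty using (⊥)
open import Data.List.NonEmpty.Base as List⁺ using (List⁺)
open import Data.List.NonEmpty.Relation.Unary.All using (All)
open import Data.Nat.Base using (ℕ)
open import Data.Product.Base using (∃; _×_)
open import Data.Sum.Base using (_⊎_)
open import Level using (0ℓ)
open import Relation.Binary.Core using (Rel)
open import Relation.Binary.Definitions using (Transitive)
open import Relation.Binary.PropositionalEquality.Core using (_≡_)
open import Relation.Nullary.Negation.Core using (¬_)
open import Relation.Unary using (Pred; _∈_; _⊆_; Satisfiable)

infix  9 ∼_
infix  8 _⇝_
infixr 7 _∧_
infixr 6 _∨_
infixr 5 _⇒_
infix  4 _⇔_

data Prop : Set where
  bot : Prop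
  var : ℕ → Prop
  _∧_ _∨_ _⇒_ _⇔_ : Prop → Prop → Prop
  ∼_ : Prop → Prop

-- The clause "every propositional formula is a formula" of the grammar is
-- rendered by the constructors bot and var together with the embedding ⌜_⌝,
-- so that p ∧ q is a single formula and not both an embedded propositional
-- conjunction and a conjunction of embedded variables.
data Form : Set where
  bot : Form
  var : ℕ → Form
  _∧_ _∨_ _⇒_ _⇔_ : Form → Form → Form
  ∼_ : Form → Form
  _⇝_ : Prop → Prop → Form
  B : Form → Form

⌜_⌝ : Prop → Form
⌜ bot ⌝   = bot
⌜ var p ⌝ = var p
⌜ φ ∧ ψ ⌝ = ⌜ φ ⌝ ∧ ⌜ ψ ⌝
⌜ φ ∨ ψ ⌝ = ⌜ φ ⌝ ∨ ⌜ ψ ⌝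
⌜ φ ⇒ ψ ⌝ = ⌜ φ ⌝ ⇒ ⌜ ψ ⌝
⌜ φ ⇔ ψ ⌝ = ⌜ φ ⌝ ⇔ ⌜ ψ ⌝
⌜ ∼ φ ⌝   = ∼ ⌜ φ ⌝

⋀ₚ : List⁺ Prop → Prop
⋀ₚ = List⁺.foldr₁ _∧_

⋀ : List⁺ Form → Form
⋀ = List⁺.foldr₁ _∧_

-- Variables, conditionals φ ⇝ ψ and beliefs B α are the atoms of classical
-- propositional logic over Form.
record Valuation : Set where
  field
    var-val  : ℕ → Bool
    cond-val : Prop → Prop → Bool
    B-val    : Form → Bool

module _ (ν : Valuation) where
  open Valuation ν

  eval : Form → Bool
  eval bot     = false
  eval (var p) = var-val p
  eval (α ∧ β) = eval α Bool.∧ eval β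
  eval (α ∨ β) = eval α Bool.∨ eval β
  eval (α ⇒ β) = Bool.not (eval α) Bool.∨ eval β
  eval (α ⇔ β) = Bool.not (eval α Bool.xor eval β)
  eval (∼ α)   = Bool.not (eval α)
  eval (φ ⇝ ψ) = cond-val φ ψ
  eval (B α)   = B-val α

Tautology : Form → Set
Tautology α = ∀ ν → eval ν α ≡ true

data CondLiteral : Pred Form 0ℓ where
  pos : ∀ φ ψ → CondLiteral (φ ⇝ ψ)
  neg : ∀ φ ψ → CondLiteral (∼ (φ ⇝ ψ))

infix 2 ⊢_ _⊢_ _⊨_

-- Theorems of SBTrust.  RCK and S5F are stated for n ≥ 1; their instances
-- with n = 0 are derivable, using ID to supply a premise.
data ⊢_ : Form → Set where
  taut : ∀ {α} → Tautology α → ⊢ α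
  MP   : ∀ {α β} → ⊢ (α ⇒ β) → ⊢ α → ⊢ β
  ID   : ∀ φ → ⊢ (φ ⇝ φ)
  ST   : ∀ φ → ⊢ ((φ ⇝ bot) ⇒ ∼ ⌜ φ ⌝)
  SH   : ∀ φ ψ χ → ⊢ (((ψ ∧ χ) ⇝ φ) ⇒ (ψ ⇝ (χ ⇒ φ)))
  LL+  : ∀ φ ψ χ → ⊢ (((∼ (φ ⇔ ψ)) ⇝ bot) ⇒ ((φ ⇝ χ) ⇔ (ψ ⇝ χ)))
  RCK  : ∀ (φs : List⁺ Prop) φ ψ →
         ⊢ ⌜ ⋀ₚ φs ⇒ φ ⌝ → ⊢ (⋀ (List⁺.map (ψ ⇝_) φs) ⇒ (ψ ⇝ φ))
  S5F  : ∀ (ℓs : List⁺ Form) χ → All CondLiteral ℓs →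
         ⊢ (⋀ ℓs ⇒ ⌜ χ ⌝) → ⊢ (⋀ ℓs ⇒ ((∼ χ) ⇝ bot))
  KB   : ∀ α β → ⊢ (B (α ⇒ β) ⇒ (B α ⇒ B β))
  DB   : ∀ α → ⊢ (B α ⇒ ∼ (B (∼ α)))
  4B   : ∀ α → ⊢ (B α ⇒ B (B α))
  NecB : ∀ {α} → ⊢ α → ⊢ B α

-- Derivability from assumptions, matching the local consequence relation _⊨_
-- below: RCK, S5F and NecB apply to theorems only, so that α ⊢ B α fails.
data _⊢_ (Φ : Pred Form 0ℓ) : Form → Set where
  assumption : ∀ {α} → α ∈ Φ → Φ ⊢ α
  thm        : ∀ {α} → ⊢ α → Φ ⊢ α
  MP         : ∀ {α β} → Φ ⊢ (α ⇒ β) → Φ ⊢ α → Φ ⊢ β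

module _ {S : Set} (V : ℕ → Pred S 0ℓ) where

  satₚ : S → Prop → Set
  satₚ s bot     = ⊥
  satₚ s (var p) = s ∈ V p
  satₚ s (φ ∧ ψ) = satₚ s φ × satₚ s ψ
  satₚ s (φ ∨ ψ) = satₚ s φ ⊎ satₚ s ψ
  satₚ s (φ ⇒ ψ) = satₚ s φ → satₚ s ψ
  satₚ s (φ ⇔ ψ) = (satₚ s φ → satₚ s ψ) × (satₚ s ψ → satₚ s φ)
  satₚ s (∼ φ)   = ¬ satₚ s φ

mostOf : {S : Set} → Rel S 0ℓ → Pred S 0ℓ → Pred S 0ℓ
mostOf _⪰_ X s = s ∈ X × (∀ v → v ∈ X → v ⪰ s → s ⪰ v)

record TrustModel : Set₁ where
  field
    S I  : Set
    Cell : I → Pred S 0ℓ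
    pref : I → Rel S 0ℓ     -- pref i v s is v ⪰ᵢ s
    R    : Rel S 0ℓ
    V    : ℕ → Pred S 0ℓ

    R-serial     : ∀ s → ∃ (R s)
    R-transitive : Transitive R

    Cell-nonempty : ∀ i → Satisfiable (Cell i)
    Cell-cover    : ∀ s → ∃ λ i → s ∈ Cell i
    Cell-disjoint : ∀ {i j s} → s ∈ Cell i → s ∈ Cell j → i ≡ j

    pref-within : ∀ {i v s} → pref i v s → v ∈ Cell i × s ∈ Cell i

  ‖_‖ : Prop → I → Pred S 0ℓ
  ‖ φ ‖ i v = v ∈ Cell i × satₚ V v φ

  most : I → Pred S 0ℓ → Pred S 0ℓ
  most i = mostOf (pref i)

  field
    most-nonempty : ∀ i φ → Satisfiable (‖ φ ‖ i) → Satisfiable (most i (‖ φ ‖ i))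

  sat : S → Form → Set
  sat s bot     = ⊥
  sat s (var p) = s ∈ V p
  sat s (α ∧ β) = sat s α × sat s β
  sat s (α ∨ β) = sat s α ⊎ sat s β
  sat s (α ⇒ β) = sat s α → sat s β
  sat s (α ⇔ β) = (sat s α → sat s β) × (sat s β → sat s α)
  sat s (∼ α)   = ¬ sat s α
  sat s (φ ⇝ ψ) = ∀ i → s ∈ Cell i → most i (‖ φ ‖ i) ⊆ ‖ ψ ‖ i
  sat s (B α)   = ∀ v → R s v → sat v α

_⊨_ : Pred Form 0ℓ → Form → Set₁
Φ ⊨ α = (M : TrustModel) → let open TrustModel M in
        (s : S) → (∀ {β} → β ∈ Φ → sat s β) → sat s α

{-# OPTIONS --safe #-}
-- Canonical model.  A maximal consistent set is a Boolean valuation of the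
-- atoms that verifies every theorem; call w chosen for φ when w satisfies every
-- ψ with φ ⇝ ψ ∈ w.  Within a class of maximal consistent sets sharing their
-- conditionals, SH and LL+ say exactly that a w chosen for φ is also chosen for
-- each stronger ψ true at w.  This property is all that is needed
-- to represent "chosen" as maximality for an arbitrary relation: take copies
-- (w , φ , n) and let (w , φ , n) be dominated by those (v , χ , n + 1) with v
-- refuting φ, or by all (v , χ , n + 1) if w is not chosen for φ.  A copy
-- (w , φ , n) is then maximal in ‖ψ‖ iff w is chosen for φ and ψ entails φ
-- throughout the class.  The counter n only serves to make domination asymmetric.
module Submission where

open import Defs
open import Axiom.ExcludedMiddle using (ExcludedMiddle)
open import Data.Bool.Base as Bool using (Bool; true; false; if_then_else_)
open import Data.Empty using (⊥-elim)
open import Data.List.Base using (List; []; _∷_; _++_; map; upTo; concat; foldl; cartesianProductWith)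
open import Data.List.Membership.Propositional as List using ()
open import Data.List.Membership.Propositional.Properties using (∈-map⁺; ∈-upTo⁺; ∈-concat⁺′; ∈-cartesianProductWith⁺)
open import Data.List.NonEmpty.Base using (_∷_)
open import Data.List.NonEmpty.Relation.Unary.All using (_∷_)
open import Data.List.Relation.Unary.All as All using (All; []; _∷_)
open import Data.List.Relation.Unary.All.Properties using (++⁺; ++⁻ˡ; ++⁻ʳ)
open import Data.List.Relation.Unary.Any using (here; there)
open import Data.Nat.Base using (ℕ; zero; suc; _+_; _≤_; _⊔_; s≤s⁻¹)
open import Data.Nat.Properties using (+-comm; ≤-refl; m⊔n≤o⇒m≤o; m⊔n≤o⇒n≤o; m≢1+m+n)
open import Data.Product.Base using (∃; _×_; _,_; proj₁; proj₂)
open import Data.Sum.Base using (_⊎_; inj₁; inj₂)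
open import Function.Base using (_∘_; id; case_of_)
open import Level using (0ℓ)
open import Relation.Binary.PropositionalEquality using (_≡_; refl; sym; trans; cong; cong₂; subst)
open import Relation.Nullary.Decidable.Core using (Dec; yes; no; does; _because_; decidable-stable)
open import Relation.Nullary.Negation.Core using (¬_; contradiction)
open import Relation.Nullary.Reflects using (Reflects; ofʸ; ofⁿ; ¬-reflects; _×-reflects_; _⊎-reflects_; _→-reflects_)
open import Relation.Unary using (Pred; _∈_; _⊆_; _∪_; ｛_｝; ∅)

open Valuation

private
  variable
    α β : Form
    φ ψ χ θ : Prop
    Φ Ψ : Pred Form 0ℓ
    ν : Valuation

-- Truth under Boolean valuations

reflects⁻ : ∀ {A : Set} {b} → Reflects A b → b ≡ true → A
reflects⁻ (ofʸ a) refl = a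

reflects⁺ : ∀ {A : Set} {b} → Reflects A b → A → b ≡ true
reflects⁺ (ofʸ _)  _ = refl
reflects⁺ (ofⁿ ¬a) a = contradiction a ¬a

_⇔-reflects_ : ∀ {A B : Set} {a b} → Reflects A a → Reflects B b →
               Reflects ((A → B) × (B → A)) (Bool.not (a Bool.xor b))
ofʸ a  ⇔-reflects ofʸ b  = ofʸ ((λ _ → b) , (λ _ → a))
ofʸ a  ⇔-reflects ofⁿ ¬b = ofⁿ λ (f , _) → ¬b (f a)
ofⁿ ¬a ⇔-reflects ofʸ b  = ofⁿ λ (_ , g) → ¬a (g b)
ofⁿ ¬a ⇔-reflects ofⁿ ¬b = ofʸ ((λ a → contradiction a ¬a) , (λ b → contradiction b ¬b))

infix 3.5 _⊩_

-- A record, because `eval ν α ≡ true` computes away and would not let `ν` and `α` be inferred.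
record _⊩_ (ν : Valuation) (α : Form) : Set where
  constructor ⟨_⟩
  field holds : eval ν α ≡ true

open _⊩_

⊩-reflects : ∀ ν α → Reflects (ν ⊩ α) (eval ν α)
⊩-reflects ν α with eval ν α in eq
... | true  = ofʸ ⟨ eq ⟩
... | false = ofⁿ λ (⟨ eq′ ⟩) → case trans (sym eq) eq′ of λ ()

_⊩?_ : ∀ ν α → Dec (ν ⊩ α)
ν ⊩? α = eval ν α because ⊩-reflects ν α

⇒⁺ : (ν ⊩ α → ν ⊩ β) → ν ⊩ α ⇒ β
⇒⁺ f = ⟨ reflects⁺ (⊩-reflects _ _ →-reflects ⊩-reflects _ _) f ⟩

⇒⁻ : ν ⊩ α ⇒ β → ν ⊩ α → ν ⊩ β
⇒⁻ p = reflects⁻ (⊩-reflects _ _ →-reflects ⊩-reflects _ _) (holds p)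

∼⁺ : ¬ ν ⊩ α → ν ⊩ ∼ α
∼⁺ f = ⟨ reflects⁺ (¬-reflects (⊩-reflects _ _)) f ⟩

∼⁻ : ν ⊩ ∼ α → ¬ ν ⊩ α
∼⁻ p = reflects⁻ (¬-reflects (⊩-reflects _ _)) (holds p)

∧⁺ : ν ⊩ α → ν ⊩ β → ν ⊩ α ∧ β
∧⁺ p q = ⟨ reflects⁺ (⊩-reflects _ _ ×-reflects ⊩-reflects _ _) (p , q) ⟩

∧⁻ : ν ⊩ α ∧ β → ν ⊩ α × ν ⊩ β
∧⁻ p = reflects⁻ (⊩-reflects _ _ ×-reflects ⊩-reflects _ _) (holds p)

⇔⁺ : (ν ⊩ α → ν ⊩ β) → (ν ⊩ β → ν ⊩ α) → ν ⊩ α ⇔ β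
⇔⁺ f g = ⟨ reflects⁺ (⊩-reflects _ _ ⇔-reflects ⊩-reflects _ _) (f , g) ⟩

⇔⁻ : ν ⊩ α ⇔ β → ν ⊩ α → ν ⊩ β
⇔⁻ p = proj₁ (reflects⁻ (⊩-reflects _ _ ⇔-reflects ⊩-reflects _ _) (holds p))

bot⁻ : ¬ ν ⊩ bot
bot⁻ ⟨ () ⟩

⋀⁺ : ∀ {α αs} → All (ν ⊩_) (α ∷ αs) → ν ⊩ ⋀ (α ∷ αs)
⋀⁺ (p ∷ [])         = p
⋀⁺ (p ∷ ps@(_ ∷ _)) = ∧⁺ p (⋀⁺ ps)

⋀⁻ : ∀ α αs → ν ⊩ ⋀ (α ∷ αs) → All (ν ⊩_) (α ∷ αs)
⋀⁻ α []       p = p ∷ []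
⋀⁻ α (β ∷ αs) p = proj₁ (∧⁻ p) ∷ ⋀⁻ β αs (proj₂ (∧⁻ p))

-- Derivability from assumptions

valid : (∀ ν → ν ⊩ α) → Φ ⊢ α
valid f = thm (taut (holds ∘ f))

weaken : Φ ⊆ Ψ → Φ ⊢ α → Ψ ⊢ α
weaken s (assumption p) = assumption (s p)
weaken s (thm t)        = thm t
weaken s (MP d e)       = MP (weaken s d) (weaken s e)

-- Only modus ponens acts on assumptions: `RCK`, `S5F` and `NecB` stay inside `thm`.
deduction : (Φ ∪ ｛ α ｝) ⊢ β → Φ ⊢ α ⇒ β
deduction (assumption (inj₁ p))    = MP (valid λ _ → ⇒⁺ λ b → ⇒⁺ λ _ → b) (assumption p)
deduction (assumption (inj₂ refl)) = valid λ _ → ⇒⁺ id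
deduction (thm t)                  = MP (valid λ _ → ⇒⁺ λ b → ⇒⁺ λ _ → b) (thm t)
deduction (MP d e)                 =
  MP (MP (valid λ _ → ⇒⁺ λ f → ⇒⁺ λ g → ⇒⁺ λ a → ⇒⁻ (⇒⁻ f a) (⇒⁻ g a)) (deduction d)) (deduction e)

Consistent : Pred Form 0ℓ → Set
Consistent Φ = ¬ (Φ ⊢ bot)

refute : (Φ ∪ ｛ α ｝) ⊢ bot → Φ ⊢ ∼ α
refute d = MP (valid λ _ → ⇒⁺ λ f → ∼⁺ (bot⁻ ∘ ⇒⁻ f)) (deduction d)

explode : Φ ⊢ ∼ α → Φ ⊢ α → Φ ⊢ bot
explode d e = MP (MP (valid λ _ → ⇒⁺ λ p → ⇒⁺ λ q → contradiction q (∼⁻ p)) d) e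

reductio : (Φ ∪ ｛ ∼ α ｝) ⊢ bot → Φ ⊢ α
reductio d = MP (valid λ ν → ⇒⁺ λ p → decidable-stable (ν ⊩? _) (∼⁻ p ∘ ∼⁺)) (refute d)

∅-⊢ : ∅ ⊢ α → ⊢ α
∅-⊢ (thm t)  = t
∅-⊢ (MP d e) = MP (∅-⊢ d) (∅-⊢ e)

-- Enumeration of the formulas

-- A left inverse of `⌜_⌝`, by which pairs of formulas also enumerate the conditionals. The value
-- `bot` at conditionals and beliefs is arbitrary.
unembed : Form → Prop
unembed (var p) = var p
unembed (α ∧ β) = unembed α ∧ unembed β
unembed (α ∨ β) = unembed α ∨ unembed β
unembed (α ⇒ β) = unembed α ⇒ unembed β
unembed (α ⇔ β) = unembed α ⇔ unembed β
unembed (∼ α)   = ∼ unembed α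
unembed _       = bot

unembed-⌜⌝ : ∀ φ → unembed ⌜ φ ⌝ ≡ φ
unembed-⌜⌝ bot     = refl
unembed-⌜⌝ (var p) = refl
unembed-⌜⌝ (φ ∧ ψ) = cong₂ _∧_ (unembed-⌜⌝ φ) (unembed-⌜⌝ ψ)
unembed-⌜⌝ (φ ∨ ψ) = cong₂ _∨_ (unembed-⌜⌝ φ) (unembed-⌜⌝ ψ)
unembed-⌜⌝ (φ ⇒ ψ) = cong₂ _⇒_ (unembed-⌜⌝ φ) (unembed-⌜⌝ ψ)
unembed-⌜⌝ (φ ⇔ ψ) = cong₂ _⇔_ (unembed-⌜⌝ φ) (unembed-⌜⌝ ψ)
unembed-⌜⌝ (∼ φ)   = cong ∼_ (unembed-⌜⌝ φ)

_⇝′_ : Form → Form → Form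
α ⇝′ β = unembed α ⇝ unembed β

heightₚ : Prop → ℕ
heightₚ bot     = 1
heightₚ (var p) = suc (suc p)
heightₚ (φ ∧ ψ) = suc (heightₚ φ ⊔ heightₚ ψ)
heightₚ (φ ∨ ψ) = suc (heightₚ φ ⊔ heightₚ ψ)
heightₚ (φ ⇒ ψ) = suc (heightₚ φ ⊔ heightₚ ψ)
heightₚ (φ ⇔ ψ) = suc (heightₚ φ ⊔ heightₚ ψ)
heightₚ (∼ φ)   = suc (heightₚ φ)

height : Form → ℕ
height bot     = 1
-- The index counts, so that each bound admits finitely many formulas. A height of at most `suc n`
-- gives `p < n`, as `upTo n` requires.
height (var p) = suc (suc p)
height (α ∧ β) = suc (height α ⊔ height β)
height (α ∨ β) = suc (height α ⊔ height β)
height (α ⇒ β) = suc (height α ⊔ height β)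
height (α ⇔ β) = suc (height α ⊔ height β)
height (∼ α)   = suc (height α)
height (φ ⇝ ψ) = suc (heightₚ φ ⊔ heightₚ ψ)
height (B α)   = suc (height α)

height-⌜⌝ : ∀ φ → height ⌜ φ ⌝ ≡ heightₚ φ
height-⌜⌝ bot     = refl
height-⌜⌝ (var p) = refl
height-⌜⌝ (φ ∧ ψ) = cong₂ (λ m n → suc (m ⊔ n)) (height-⌜⌝ φ) (height-⌜⌝ ψ)
height-⌜⌝ (φ ∨ ψ) = cong₂ (λ m n → suc (m ⊔ n)) (height-⌜⌝ φ) (height-⌜⌝ ψ)
height-⌜⌝ (φ ⇒ ψ) = cong₂ (λ m n → suc (m ⊔ n)) (height-⌜⌝ φ) (height-⌜⌝ ψ)
height-⌜⌝ (φ ⇔ ψ) = cong₂ (λ m n → suc (m ⊔ n)) (height-⌜⌝ φ) (height-⌜⌝ ψ)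
height-⌜⌝ (∼ φ)   = cong suc (height-⌜⌝ φ)

forms : ℕ → List Form
formLists : ℕ → List (List Form)

forms zero    = []
forms (suc n) = concat (formLists n)

formLists n =
  (bot ∷ []) ∷ map var (upTo n) ∷ map ∼_ (forms n) ∷ map B (forms n) ∷
  cartesianProductWith _∧_ (forms n) (forms n) ∷
  cartesianProductWith _∨_ (forms n) (forms n) ∷
  cartesianProductWith _⇒_ (forms n) (forms n) ∷
  cartesianProductWith _⇔_ (forms n) (forms n) ∷
  cartesianProductWith _⇝′_ (forms n) (forms n) ∷ []

∈-forms : ∀ n α → height α ≤ n → α List.∈ forms n
∈-pairs : ∀ n (_•_ : Form → Form → Form) α β → height α ⊔ height β ≤ n →
          (α • β) List.∈ cartesianProductWith _•_ (forms n) (forms n)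

∈-pairs n _•_ α β h = ∈-cartesianProductWith⁺ _•_
  (∈-forms n α (m⊔n≤o⇒m≤o (height α) (height β) h))
  (∈-forms n β (m⊔n≤o⇒n≤o (height α) (height β) h))

∈-formLists : ∀ n {αs} → α List.∈ αs → αs List.∈ formLists n → α List.∈ forms (suc n)
∈-formLists n = ∈-concat⁺′ {xss = formLists n}

∈-forms (suc n) bot     h = here refl
∈-forms (suc n) (var p) h = ∈-formLists n (∈-map⁺ var (∈-upTo⁺ (s≤s⁻¹ h))) (there (here refl))
∈-forms (suc n) (∼ α)   h = ∈-formLists n (∈-map⁺ ∼_ (∈-forms n α (s≤s⁻¹ h))) (there (there (here refl)))
∈-forms (suc n) (B α)   h = ∈-formLists n (∈-map⁺ B (∈-forms n α (s≤s⁻¹ h))) (there (there (there (here refl))))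
∈-forms (suc n) (α ∧ β) h =
  ∈-formLists n (∈-pairs n _∧_ α β (s≤s⁻¹ h)) (there (there (there (there (here refl)))))
∈-forms (suc n) (α ∨ β) h =
  ∈-formLists n (∈-pairs n _∨_ α β (s≤s⁻¹ h)) (there (there (there (there (there (here refl))))))
∈-forms (suc n) (α ⇒ β) h =
  ∈-formLists n (∈-pairs n _⇒_ α β (s≤s⁻¹ h)) (there (there (there (there (there (there (here refl)))))))
∈-forms (suc n) (α ⇔ β) h =
  ∈-formLists n (∈-pairs n _⇔_ α β (s≤s⁻¹ h)) (there (there (there (there (there (there (there (here refl))))))))
∈-forms (suc n) (φ ⇝ ψ) h =
  subst (List._∈ forms (suc n)) (cong₂ _⇝_ (unembed-⌜⌝ φ) (unembed-⌜⌝ ψ))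
    (∈-formLists n (∈-pairs n _⇝′_ ⌜ φ ⌝ ⌜ ψ ⌝
        (subst (_≤ n) (sym (cong₂ _⊔_ (height-⌜⌝ φ) (height-⌜⌝ ψ))) (s≤s⁻¹ h)))
      (there (there (there (there (there (there (there (there (here refl))))))))))

-- Maximal consistent sets

record World : Set where
  field
    valuation : Valuation
    sound     : ⊢ α → valuation ⊩ α

open World

sound-⊢ : ∀ w → Φ ⊆ (valuation w ⊩_) → Φ ⊢ α → valuation w ⊩ α
sound-⊢ w h (assumption p) = h p
sound-⊢ w h (thm t)        = sound w t
sound-⊢ w h (MP d e)       = ⇒⁻ (sound-⊢ w h d) (sound-⊢ w h e)

-- A derivation uses finitely many assumptions; they are listed because `S5F` takes only a finite
-- list of literals.
compact : Φ ⊢ α → ∃ λ αs → All Φ αs × (∀ w → All (valuation w ⊩_) αs → valuation w ⊩ α)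
compact (assumption {α} p) = α ∷ [] , p ∷ [] , λ _ → All.head
compact (thm t)            = [] , [] , λ w _ → sound w t
compact (MP d e) with compact d | compact e
... | αs , ps , f | βs , qs , g =
  αs ++ βs , ++⁺ ps qs , λ w h → ⇒⁻ (f w (++⁻ˡ αs h)) (g w (++⁻ʳ αs h))

Agree : World → World → Set
Agree w v = ∀ φ ψ → cond-val (valuation w) φ ψ ≡ cond-val (valuation v) φ ψ

transport : ∀ {w v} → Agree w v → valuation w ⊩ φ ⇝ ψ → valuation v ⊩ φ ⇝ ψ
transport {φ} {ψ} a ⟨ p ⟩ = ⟨ trans (sym (a φ ψ)) p ⟩

Agree-sym : ∀ {w v} → Agree w v → Agree v w
Agree-sym a φ ψ = sym (a φ ψ)

Agree-trans : ∀ {u v w} → Agree u v → Agree v w → Agree u w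
Agree-trans a b φ ψ = trans (a φ ψ) (b φ ψ)

-- An axiomatisation of the class of `w`: the worlds that satisfy it are exactly those that agree
-- with `w`.
Literals : World → Pred Form 0ℓ
Literals w α = CondLiteral α × valuation w ⊩ α

Literals-Agree : ∀ {w v} → Agree w v → Literals w ⊆ (valuation v ⊩_)
Literals-Agree {w} {v} a (pos φ ψ , p) = transport {w = w} {v} a p
Literals-Agree {w} {v} a (neg φ ψ , p) = ∼⁺ (∼⁻ p ∘ transport {w = v} {w} (Agree-sym {w} {v} a))

Agree-Literals : ∀ {w v} → Literals w ⊆ (valuation v ⊩_) → Agree w v
Agree-Literals {w} {v} h φ ψ with cond-val (valuation w) φ ψ in eq
... | true  = sym (holds (h (pos φ ψ , ⟨ eq ⟩)))
... | false with cond-val (valuation v) φ ψ in eq′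
...   | false = refl
...   | true  = contradiction ⟨ eq′ ⟩ (∼⁻ (h (neg φ ψ , ⟨ cong Bool.not eq ⟩)))

Chosen : World → Prop → Set
Chosen w φ = ∀ ψ → valuation w ⊩ φ ⇝ ψ → valuation w ⊩ ⌜ ψ ⌝

Chosen-self : ∀ w → Chosen w φ → valuation w ⊩ ⌜ φ ⌝
Chosen-self w c = c _ (sound w (ID _))

Accessible : World → World → Set
Accessible w v = ∀ α → valuation w ⊩ B α → valuation v ⊩ α

Believed : World → Pred Form 0ℓ
Believed w α = valuation w ⊩ B α

-- `NecB` and `KB` carry derivations under `B`.
Believed-closed : ∀ w → Believed w ⊢ α → α ∈ Believed w
Believed-closed w (assumption p) = p
Believed-closed w (thm t)        = sound w (NecB t)
Believed-closed w (MP d e)       =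
  ⇒⁻ (⇒⁻ (sound w (KB _ _)) (Believed-closed w d)) (Believed-closed w e)

Believed-consistent : ∀ w → Consistent (Believed w)
Believed-consistent w d =
  -- By `DB`, believing `bot` excludes believing the tautology `∼ bot`.
  ∼⁻ (⇒⁻ (sound w (DB bot)) (Believed-closed w d)) (sound w (NecB (taut λ _ → refl)))

Accessible-trans : ∀ {u v w} → Accessible u v → Accessible v w → Accessible u w
Accessible-trans {u} r s α p = s α (r (B α) (⇒⁻ (sound u (4B α)) p))

module Classical (em : ExcludedMiddle 0ℓ) where

  -- Lindenbaum's lemma

  -- The consistency test is part of membership, so the set is defined without deciding it first.
  extend : Pred Form 0ℓ → Form → Pred Form 0ℓ
  extend Φ α β = β ∈ Φ ⊎ (α ≡ β × Consistent (Φ ∪ ｛ α ｝))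

  extend-consistent : ∀ α → Consistent Φ → Consistent (extend Φ α)
  extend-consistent {Φ} α con d with em {(Φ ∪ ｛ α ｝) ⊢ bot}
  ... | yes incon = con (weaken (λ { (inj₁ p) → p ; (inj₂ (_ , c)) → contradiction incon c }) d)
  ... | no con′   = con′ (weaken (λ { (inj₁ p) → inj₁ p ; (inj₂ (p , _)) → inj₂ p }) d)

  Decides : Pred Form 0ℓ → Form → Set
  Decides Φ α = (Φ ⊢ α) ⊎ (Φ ⊢ ∼ α)

  Decides-⊆ : Φ ⊆ Ψ → Decides Φ α → Decides Ψ α
  Decides-⊆ s (inj₁ d) = inj₁ (weaken s d)
  Decides-⊆ s (inj₂ d) = inj₂ (weaken s d)

  extend-decides : ∀ Φ α → Decides (extend Φ α) α
  extend-decides Φ α with em {(Φ ∪ ｛ α ｝) ⊢ bot}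
  ... | yes incon = inj₂ (weaken inj₁ (refute incon))
  ... | no con    = inj₁ (assumption (inj₂ (refl , con)))

  extendAll : Pred Form 0ℓ → List Form → Pred Form 0ℓ
  extendAll = foldl extend

  extendAll-⊇ : ∀ αs → Φ ⊆ extendAll Φ αs
  extendAll-⊇ []       p = p
  extendAll-⊇ (α ∷ αs) p = extendAll-⊇ αs (inj₁ p)

  extendAll-consistent : ∀ αs → Consistent Φ → Consistent (extendAll Φ αs)
  extendAll-consistent []       con = con
  extendAll-consistent (α ∷ αs) con = extendAll-consistent αs (extend-consistent α con)

  extendAll-decides : ∀ αs → α List.∈ αs → Decides (extendAll Φ αs) α
  extendAll-decides {Φ = Φ} (α ∷ αs) (here refl) = Decides-⊆ (extendAll-⊇ αs) (extend-decides Φ α)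
  extendAll-decides (_ ∷ αs) (there i)           = extendAll-decides αs i

  stage : Pred Form 0ℓ → ℕ → Pred Form 0ℓ
  stage Φ zero    = Φ
  stage Φ (suc n) = extendAll (stage Φ n) (forms n)

  stage-⊆ : ∀ m n → stage Φ n ⊆ stage Φ (m + n)
  stage-⊆ zero    n p = p
  stage-⊆ (suc m) n p = extendAll-⊇ (forms (m + n)) (stage-⊆ m n p)

  stage-consistent : Consistent Φ → ∀ n → Consistent (stage Φ n)
  stage-consistent con zero    = con
  stage-consistent con (suc n) = extendAll-consistent (forms n) (stage-consistent con n)

  limit : Pred Form 0ℓ → Pred Form 0ℓ
  limit Φ α = ∃ λ n → α ∈ stage Φ n

  limit-compact : limit Φ ⊢ α → ∃ λ n → stage Φ n ⊢ α
  limit-compact (assumption (n , p)) = n , assumption p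
  limit-compact (thm t)              = 0 , thm t
  limit-compact {Φ = Φ} (MP d e) with limit-compact d | limit-compact e
  ... | m , d′ | n , e′ =
    m + n , MP (weaken (subst (λ k → stage Φ m ⊆ stage Φ k) (+-comm n m) (stage-⊆ n m)) d′)
               (weaken (stage-⊆ m n) e′)

  limit-consistent : Consistent Φ → Consistent (limit Φ)
  limit-consistent con d with limit-compact d
  ... | n , d′ = stage-consistent con n d′

  limit-decides : ∀ Φ α → Decides (limit Φ) α
  limit-decides Φ α =
    -- `α` occurs in `forms (height α)`, the list processed on the way to stage `suc (height α)`.
    Decides-⊆ (λ p → suc (height α) , p)
      (extendAll-decides (forms (height α)) (∈-forms (height α) α ≤-refl))

  module Lindenbaum (Φ : Pred Form 0ℓ) (con : Consistent Φ) where

    derivable : Form → Bool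
    derivable α = does (em {limit Φ ⊢ α})

    canonical : Valuation
    canonical = record
      { var-val  = λ p → derivable (var p)
      ; cond-val = λ φ ψ → derivable (φ ⇝ ψ)
      ; B-val    = λ α → derivable (B α)
      }

    literal : Bool → Form → Form
    literal b α = if b then α else ∼ α

    literal⁺ : ∀ b → eval ν α ≡ b → ν ⊩ literal b α
    literal⁺ true  p = ⟨ p ⟩
    literal⁺ false p = ⟨ cong Bool.not p ⟩

    literal⁻ : ∀ b → ν ⊩ literal b α → eval ν α ≡ b
    literal⁻ true  p = holds p
    literal⁻ {ν} {α} false p with eval ν α in eq
    ... | false = refl
    ... | true  = contradiction ⟨ eq ⟩ (∼⁻ p)

    literal-atom : ∀ α → limit Φ ⊢ literal (derivable α) α
    literal-atom α with em {limit Φ ⊢ α}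
    ... | yes d = d
    ... | no ¬d with limit-decides Φ α
    ...   | inj₁ d = contradiction d ¬d
    ...   | inj₂ d = d

    -- The literals of `α` and `β` fix both values under any valuation, hence that of `γ`; so the
    -- implication between the literals is a tautology, whatever the connective.
    literal-binary : ∀ α β γ (f : Bool → Bool → Bool) →
                     (∀ ν → eval ν γ ≡ f (eval ν α) (eval ν β)) →
                     limit Φ ⊢ literal (eval canonical α) α →
                     limit Φ ⊢ literal (eval canonical β) β →
                     limit Φ ⊢ literal (eval canonical γ) γ
    literal-binary α β γ f h d e =
      MP (MP (valid λ ν → ⇒⁺ λ p → ⇒⁺ λ q → literal⁺ (eval canonical γ)
                (trans (h ν) (trans (cong₂ f (literal⁻ _ p) (literal⁻ _ q)) (sym (h canonical))))) d) e

    -- Kalmár's lemma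
    literal-eval : ∀ α → limit Φ ⊢ literal (eval canonical α) α
    literal-eval bot     = valid λ _ → ⟨ refl ⟩
    literal-eval (var p) = literal-atom (var p)
    literal-eval (α ∧ β) =
      literal-binary α β (α ∧ β) Bool._∧_ (λ _ → refl) (literal-eval α) (literal-eval β)
    literal-eval (α ∨ β) =
      literal-binary α β (α ∨ β) Bool._∨_ (λ _ → refl) (literal-eval α) (literal-eval β)
    literal-eval (α ⇒ β) =
      literal-binary α β (α ⇒ β) (λ a b → Bool.not a Bool.∨ b) (λ _ → refl) (literal-eval α) (literal-eval β)
    literal-eval (α ⇔ β) =
      literal-binary α β (α ⇔ β) (λ a b → Bool.not (a Bool.xor b)) (λ _ → refl) (literal-eval α) (literal-eval β)
    literal-eval (∼ α)   =
      literal-binary α α (∼ α) (λ a _ → Bool.not a) (λ _ → refl) (literal-eval α) (literal-eval α)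
    literal-eval (φ ⇝ ψ) = literal-atom (φ ⇝ ψ)
    literal-eval (B α)   = literal-atom (B α)

    limit-sound : limit Φ ⊢ α → canonical ⊩ α
    limit-sound {α} d with eval canonical α in eq
    ... | true  = ⟨ eq ⟩
    ... | false = ⊥-elim (limit-consistent con
                    (explode (subst (λ b → limit Φ ⊢ literal b α) eq (literal-eval α)) d))

    world : World
    world = record { valuation = canonical ; sound = limit-sound ∘ thm }

    Φ-holds : Φ ⊆ (canonical ⊩_)
    Φ-holds p = limit-sound (assumption (0 , p))

  abstract
    -- By `reductio`, `Φ` together with `∼ α` is consistent and extends to a world. The construction
    -- is kept abstract, as only the stated properties matter later.
    separate : ¬ (Φ ⊢ α) → ∃ λ w → Φ ⊆ (valuation w ⊩_) × ¬ valuation w ⊩ α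
    separate {Φ} {α} ¬d = world , Φ-holds ∘ inj₁ , ∼⁻ (Φ-holds (inj₂ refl))
      where open Lindenbaum (Φ ∪ ｛ ∼ α ｝) (¬d ∘ reductio)

  -- The contrapositive of `separate`; it lets derivations be replaced by checks at worlds.
  complete : (∀ w → Φ ⊆ (valuation w ⊩_) → valuation w ⊩ α) → Φ ⊢ α
  complete f = decidable-stable em λ ¬d → case separate ¬d of λ (w , h , ¬p) → ¬p (f w h)

  complete-thm : (∀ w → valuation w ⊩ α) → ⊢ α
  complete-thm f = ∅-⊢ (complete λ w _ → f w)

  -- Conditionals in a maximal consistent set

  weaken-⇝ : ∀ w → (∀ v → valuation v ⊩ ⌜ ψ ⇒ χ ⌝) → valuation w ⊩ φ ⇝ ψ → valuation w ⊩ φ ⇝ χ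
  weaken-⇝ {ψ} {χ} {φ} w f p = ⇒⁻ (sound w (RCK (ψ ∷ []) χ φ (complete-thm f))) p

  combine-⇝ : ∀ w → (∀ v → valuation v ⊩ ⌜ ψ ∧ χ ⇒ θ ⌝) →
              valuation w ⊩ φ ⇝ ψ → valuation w ⊩ φ ⇝ χ → valuation w ⊩ φ ⇝ θ
  combine-⇝ {ψ} {χ} {θ} {φ} w f p q =
    ⇒⁻ (sound w (RCK (ψ ∷ χ ∷ []) θ φ (complete-thm f))) (∧⁺ p q)

  -- `compact` leaves finitely many literals true at `w`, which form the premise of `S5F`.
  necessary : ∀ w → Literals w ⊢ ⌜ θ ⌝ → valuation w ⊩ (∼ θ) ⇝ bot
  necessary {θ} w d with compact d
  ... | αs , ls , f =
    -- bot ⇝ bot makes the list of literals non-empty.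
    ⇒⁻ (sound w (S5F ((bot ⇝ bot) ∷ αs) θ (pos bot bot ∷ All.map proj₁ ls)
                  (complete-thm λ v → ⇒⁺ λ p → f v (All.tail (⋀⁻ _ αs p)))))
       (⋀⁺ (sound w (ID bot) ∷ All.map proj₂ ls))

  -- An equivalence that holds throughout the class follows from the literals, so `necessary`
  -- supplies the antecedent of `LL+`.
  equivalent : ∀ w → (∀ v → Agree w v → valuation v ⊩ ⌜ φ ⇔ ψ ⌝) →
               valuation w ⊩ φ ⇝ χ → valuation w ⊩ ψ ⇝ χ
  equivalent {φ} {ψ} {χ} w f =
    ⇔⁻ (⇒⁻ (sound w (LL+ φ ψ χ)) (necessary w (complete λ v h → f v (Agree-Literals {w} {v} h))))

  -- `ID` and `RCK` give `(φ ∧ θ) ⇝ θ`, and within the class `φ ∧ θ` is equivalent to `φ`.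
  Literals-⇝ : ∀ w → Literals w ⊢ ⌜ θ ⌝ → valuation w ⊩ φ ⇝ θ
  Literals-⇝ {θ} {φ} w d =
    equivalent {φ ∧ θ} {φ} w
      (λ v a → ⇔⁺ (proj₁ ∘ ∧⁻) (λ p → ∧⁺ p (sound-⊢ v (Literals-Agree {w} {v} a) d)))
      (weaken-⇝ {φ ∧ θ} {θ} w (λ _ → ⇒⁺ (proj₂ ∘ ∧⁻)) (sound w (ID (φ ∧ θ))))

  Consequents : World → Prop → Pred Form 0ℓ
  Consequents w φ α = ∃ λ ψ → ⌜ ψ ⌝ ≡ α × valuation w ⊩ φ ⇝ ψ

  -- By `RCK` the consequents are closed under conjunction, so those used in a derivation merge into
  -- one. Where none is used, `ID` offers `φ` as a default.
  condense : ∀ w φ → (Literals w ∪ Consequents w φ) ⊢ α →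
             ∃ λ ψ → valuation w ⊩ φ ⇝ ψ × (Literals w ⊢ ⌜ ψ ⌝ ⇒ α)
  condense w φ (assumption (inj₁ l))              =
    φ , sound w (ID φ) , complete λ _ h → ⇒⁺ λ _ → h l
  condense w φ (assumption (inj₂ (ψ , refl , p))) = ψ , p , valid λ _ → ⇒⁺ id
  condense w φ (thm t)                            =
    φ , sound w (ID φ) , complete λ v _ → ⇒⁺ λ _ → sound v t
  condense w φ (MP d e) with condense w φ d | condense w φ e
  ... | ψ , p , d′ | χ , q , e′ =
    ψ ∧ χ , combine-⇝ {ψ} {χ} {ψ ∧ χ} w (λ _ → ⇒⁺ id) p q ,
    complete λ v h → ⇒⁺ λ r →
      ⇒⁻ (⇒⁻ (sound-⊢ v h d′) (proj₁ (∧⁻ r))) (⇒⁻ (sound-⊢ v h e′) (proj₂ (∧⁻ r)))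

  -- Were `ψ` derivable from the literals and consequents, `condense` and `Literals-⇝` would give
  -- `φ ⇝ χ` and `φ ⇝ (χ ⇒ ψ)`, hence `φ ⇝ ψ` by `RCK`.
  Chosen-exists : ∀ w φ ψ → ¬ valuation w ⊩ φ ⇝ ψ →
                  ∃ λ v → Agree w v × Chosen v φ × ¬ valuation v ⊩ ⌜ ψ ⌝
  Chosen-exists w φ ψ ¬p with separate {Literals w ∪ Consequents w φ} {⌜ ψ ⌝} underivable
    where
    underivable : ¬ ((Literals w ∪ Consequents w φ) ⊢ ⌜ ψ ⌝)
    underivable d with condense w φ d
    ... | χ , q , e =
      ¬p (combine-⇝ {χ} {χ ⇒ ψ} {ψ} w (λ _ → ⇒⁺ λ r → ⇒⁻ (proj₂ (∧⁻ r)) (proj₁ (∧⁻ r)))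
           q (Literals-⇝ w e))
  ... | v , h , ¬q = v , a , c , ¬q
    where
    a : Agree w v
    a = Agree-Literals {w} {v} (h ∘ inj₁)

    c : Chosen v φ
    c χ p = h (inj₂ (χ , refl , transport {w = v} {w} (Agree-sym {w} {v} a) p))

  -- Within the class `ψ` is equivalent to `φ ∧ ψ`, so `ψ ⇝ χ` becomes `(φ ∧ ψ) ⇝ χ` and, by `SH`,
  -- `φ ⇝ (ψ ⇒ χ)`.
  Chosen-shrink : ∀ w φ ψ → (∀ v → Agree w v → valuation v ⊩ ⌜ ψ ⌝ → valuation v ⊩ ⌜ φ ⌝) →
                  valuation w ⊩ ⌜ ψ ⌝ → Chosen w φ → Chosen w ψ
  Chosen-shrink w φ ψ f p c χ q =
    ⇒⁻ (c (ψ ⇒ χ) (⇒⁻ (sound w (SH χ φ ψ))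
         (equivalent {ψ} {φ ∧ ψ} w (λ v a → ⇔⁺ (λ r → ∧⁺ (f v a r) r) (proj₂ ∘ ∧⁻)) q))) p

  -- The canonical model

  -- Cells are indexed by representatives, hence repeated, because the quotient
  -- of World by Agree is not available.
  record State : Set where
    field
      cell world : World
      agree      : Agree cell world
      label      : Prop
      level      : ℕ

  open State

  infix 3.5 _⊩ˢ_

  _⊩ˢ_ : State → Form → Set
  s ⊩ˢ α = valuation (world s) ⊩ α

  Dominates : World → State → State → Set
  Dominates i t s = (cell t ≡ i × cell s ≡ i) × level t ≡ suc (level s) ×
                    (Chosen (world s) (label s) → ¬ t ⊩ˢ ⌜ label s ⌝)

  -- Otherwise `level s` would equal itself plus two. Hence a maximal state of a set has no
  -- dominator in that set.
  Dominates-asym : ∀ i s t → Dominates i t s → ¬ Dominates i s t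
  Dominates-asym i s t (_ , p , _) (_ , q , _) =
    m≢1+m+n (level s) {1} (trans q (trans (cong suc p) (cong suc (+-comm 1 (level s)))))

  V₀ : ℕ → Pred State 0ℓ
  V₀ p s = s ⊩ˢ var p

  -- Proved before the model exists, since the field `most-nonempty` already needs it.
  truthₚ : ∀ s φ → Reflects (satₚ V₀ s φ) (eval (valuation (world s)) ⌜ φ ⌝)
  truthₚ s bot     = ofⁿ λ ()
  truthₚ s (var p) = ⊩-reflects _ _
  truthₚ s (φ ∧ ψ) = truthₚ s φ ×-reflects truthₚ s ψ
  truthₚ s (φ ∨ ψ) = truthₚ s φ ⊎-reflects truthₚ s ψ
  truthₚ s (φ ⇒ ψ) = truthₚ s φ →-reflects truthₚ s ψ
  truthₚ s (φ ⇔ ψ) = truthₚ s φ ⇔-reflects truthₚ s ψ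
  truthₚ s (∼ φ)   = ¬-reflects (truthₚ s φ)

  satₚ⇒⊩ : ∀ s φ → satₚ V₀ s φ → s ⊩ˢ ⌜ φ ⌝
  satₚ⇒⊩ s φ p = ⟨ reflects⁺ (truthₚ s φ) p ⟩

  ⊩⇒satₚ : ∀ s φ → s ⊩ˢ ⌜ φ ⌝ → satₚ V₀ s φ
  ⊩⇒satₚ s φ p = reflects⁻ (truthₚ s φ) (holds p)

  -- This is `‖ φ ‖ i` of the canonical model, written out ahead of its definition.
  Extension : Prop → World → Pred State 0ℓ
  Extension φ i s = cell s ≡ i × satₚ V₀ s φ

  chosenState : ∀ i w → Agree i w → Prop → State
  chosenState i w a φ = record { cell = i ; world = w ; agree = a ; label = φ ; level = 0 }

  -- Every dominator refutes the label `φ` and so lies outside the extension.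
  chosenState-most : ∀ i w (a : Agree i w) φ → Chosen w φ →
                     chosenState i w a φ ∈ mostOf (Dominates i) (Extension φ i)
  chosenState-most i w a φ c =
    (refl , ⊩⇒satₚ _ φ (Chosen-self w c)) ,
    λ t (_ , p) (_ , _ , f) → contradiction (satₚ⇒⊩ t φ p) (f c)

  -- If `label s` failed at a `φ`-world of the class, or `world s` were not chosen for `label s`, a
  -- state one level up would dominate `s` inside the extension. So `Chosen-shrink` applies.
  most-Chosen : ∀ i φ s → s ∈ mostOf (Dominates i) (Extension φ i) → Chosen (world s) φ
  most-Chosen i φ s ((refl , p) , maximal) =
    Chosen-shrink (world s) (label s) φ
      (λ v a q → decidable-stable (valuation v ⊩? _) λ ¬r →
        undominated v (Agree-trans {cell s} {world s} {v} (agree s) a) q λ _ → ¬r)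
      (satₚ⇒⊩ s φ p)
      (decidable-stable em λ ¬c →
        undominated (world s) (agree s) (satₚ⇒⊩ s φ p) λ c → contradiction c ¬c)
    where
    undominated : ∀ v → Agree (cell s) v → valuation v ⊩ ⌜ φ ⌝ →
                  ¬ (Chosen (world s) (label s) → ¬ valuation v ⊩ ⌜ label s ⌝)
    undominated v a q f =
      Dominates-asym (cell s) s t dominates (maximal t (refl , ⊩⇒satₚ t φ q) dominates)
      where
      t : State
      -- Domination reads only the cell, world and level of the dominating state; the label `bot` is
      -- arbitrary.
      t = record { cell = cell s ; world = v ; agree = a ; label = bot ; level = suc (level s) }

      dominates : Dominates (cell s) t s
      dominates = (refl , refl) , refl , f

  rootState : World → State
  rootState w = chosenState w w (λ _ _ → refl) bot

  canonicalModel : TrustModel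
  canonicalModel = record
    { S             = State
    ; I             = World
    ; Cell          = λ i s → cell s ≡ i
    ; pref          = Dominates
    ; R             = λ s t → Accessible (world s) (world t)
    ; V             = V₀
    ; R-serial      = λ s → case separate (Believed-consistent (world s)) of
                        λ (v , h , _) → rootState v , λ _ p → h p
    ; R-transitive  = λ {s} {t} {u} → Accessible-trans {world s} {world t} {world u}
    ; Cell-nonempty = λ i → rootState i , refl
    ; Cell-cover    = λ s → cell s , refl
    ; Cell-disjoint = λ p q → trans (sym p) q
    ; pref-within   = proj₁
    ; most-nonempty = most-nonempty
    }
    where
    most-nonempty : ∀ i φ → ∃ (Extension φ i) → ∃ (mostOf (Dominates i) (Extension φ i))
    most-nonempty i φ (s , refl , p)
      -- As `φ` is true at `s`, `ST` excludes `φ ⇝ bot`, so the class has a world chosen for `φ`.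
      with Chosen-exists (world s) φ bot
             (λ q → ∼⁻ (⇒⁻ (sound (world s) (ST φ)) q) (satₚ⇒⊩ s φ p))
    ... | v , a , c , _ = _ , chosenState-most i v (Agree-trans {i} {world s} {v} (agree s) a) φ c

  -- Truth lemma and completeness

  open TrustModel canonicalModel using (sat)

  ⊩-equivalent : ∀ {A : Set} → (ν ⊩ α → A) → (¬ ν ⊩ α → ¬ A) → Reflects A (eval ν α)
  ⊩-equivalent {ν} {α} f g with eval ν α | ⊩-reflects ν α
  ... | true  | ofʸ p  = ofʸ (f p)
  ... | false | ofⁿ ¬p = ofⁿ (g ¬p)

  truth : ∀ s α → Reflects (sat s α) (eval (valuation (world s)) α)
  truth s bot     = ofⁿ λ ()
  truth s (var p) = ⊩-reflects _ _
  truth s (α ∧ β) = truth s α ×-reflects truth s β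
  truth s (α ∨ β) = truth s α ⊎-reflects truth s β
  truth s (α ⇒ β) = truth s α →-reflects truth s β
  truth s (α ⇔ β) = truth s α ⇔-reflects truth s β
  truth s (∼ α)   = ¬-reflects (truth s α)
  truth s (φ ⇝ ψ) = ⊩-equivalent {valuation (world s)} {φ ⇝ ψ} to from
    where
    to : s ⊩ˢ φ ⇝ ψ → sat s (φ ⇝ ψ)
    -- The conditional travels from `world s` to the common representative `i` and on to `world t`.
    to p i refl {t} m@((q , _) , _) =
      q , ⊩⇒satₚ t ψ (most-Chosen i φ t m ψ
            (transport {w = i} {world t} (subst (λ j → Agree j (world t)) q (agree t))
              (transport {w = world s} {i} (Agree-sym {i} {world s} (agree s)) p)))

    from : ¬ s ⊩ˢ φ ⇝ ψ → ¬ sat s (φ ⇝ ψ)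
    from ¬p f with Chosen-exists (world s) φ ψ ¬p
    ... | v , a , c , ¬q =
      ¬q (satₚ⇒⊩ _ ψ (proj₂ (f (cell s) refl (chosenState-most (cell s) v
           (Agree-trans {cell s} {world s} {v} (agree s) a) φ c))))
  truth s (B α)   = ⊩-equivalent {valuation (world s)} {B α}
    (λ p t r → reflects⁻ (truth t α) (holds (r α p)))
    -- An unbelieved `α` is underivable from the believed formulas, and a world separating them is
    -- accessible.
    (λ ¬p f → case separate (¬p ∘ Believed-closed (world s)) of
      λ (v , h , ¬q) → ¬q ⟨ reflects⁺ (truth (rootState v) α) (f (rootState v) (λ _ → h)) ⟩)

theorem5 : ExcludedMiddle 0ℓ → (Φ : Pred Form 0ℓ) (α : Form) → Φ ⊨ α → Φ ⊢ α
theorem5 em Φ α Φ⊨α = complete λ w h →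
  ⟨ reflects⁺ (truth (rootState w) α)
      (Φ⊨α canonicalModel (rootState w) λ {β} p → reflects⁻ (truth (rootState w) β) (holds (h p))) ⟩
  where open Classical em
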